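{- Let $G$ be a graph without isolated vertices and let $H$ be a nontrivial graph. Then $$\gamma_R(G\circ H)=\begin{cases}2\gamma(G) & \text{if } \Delta(H)=|V(H)|-1,\\ \zeta(G) & \text{if } \Delta(H)=|V(H)|-2,\\ 2\gamma_t(G) & \text{if } \Delta(H)\le |V(H)|-3.\end{cases}$$
   Context: All graphs are finite, simple and undirected; a graph is nontrivial if it has at least two vertices. $\Delta(H)$ is the maximum degree of $H$; $N(v)$ is the open neighbourhood of $v$. $\gamma(G)$ is the minimum size of a dominating set (a set $S$ such that every vertex outside $S$ has a neighbour in $S$). For $G$ without isolated vertices, $\gamma_t(G)$ is the minimum size of a total dominating set (a set $S$ such that every vertex of $G$ has a neighbour in $S$). A Roman dominating function (RDF) on a graph $\Gamma$ is a function $f:V(\Gamma)\to\{0,1,2\}$ such that every vertex $u$ with $f(u)=0$ is adjacent to at least one vertex $v$ with $f(v)=2$. Its weight is $\sum_{v}f(v)$, and $\gamma_R(\Gamma)$ is the minimum weight of an RDF on $\Gamma$. An ordered couple $(A,B)$ of disjoint sets $A,B\subseteq V(G)$ is a dominating couple of $G$ if every vertex $x\in V(G)\setminus B$ satisfies $N(x)\cap(A\cup B)\ne\varnothing$. Define $\zeta(G)=\min\{2|A|+3|B| : (A,B)\text{ is a dominating couple of }G\}$. The lexicographic product $G\circ H$ has vertex set $V(G)\times V(H)$, with $(u,v)$ adjacent to $(x,y)$ iff $ux\in E(G)$, or $u=x$ and $vy\in E(H)$. -}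

module Defs where

open import Data.Bool.Base using (Bool; true; false; if_then_else_)
open import Data.Bool.Properties using () renaming (_≟_ to _≟ᵇ_)
open import Data.Fin.Base using (Fin; toℕ; funToFin; finToFun)
open import Data.Fin.Patterns using (0F; 2F)
open import Data.Fin.Properties using (any?; all?; finToFun-funToFin; *↔×; 2↔Bool)
  renaming (_≟_ to _≟ᶠ_)
open import Data.List.Base using (tabulate)
open import Data.List.Extrema.Nat using (max)
open import Data.Nat.Base using (ℕ; _+_; _*_; _≤_; _<_; _^_)
open import Data.Nat.Induction using (<-rec)
open import Data.Nat.Properties using (+-0-commutativeMonoid; _<?_; ≮⇒≥)
open import Data.Product.Base using (∃; ∃-syntax; _×_; _,_; proj₁; proj₂)
open import Data.Product.Function.NonDependent.Propositional using (_×-↔_)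
open import Data.Sum.Base using (_⊎_; inj₁; inj₂)
open import Function.Base using (_∘_; const)
open import Function.Bundles using (_↔_; Inverse)
open import Function.Construct.Composition using (_↔-∘_)
open import Function.Construct.Identity using (↔-id)
open import Function.Construct.Symmetry using (↔-sym)
open import Level using (0ℓ)
open import Relation.Binary.Core using (Rel)
open import Relation.Binary.Definitions using (Symmetric; Irreflexive; DecidableEquality)
  renaming (Decidable to Decidable₂)
open import Relation.Binary.PropositionalEquality
  using (_≡_; refl; sym; trans; cong; cong₂; subst; _≗_)
open import Relation.Nullary.Decidable
  using (Dec; yes; no; does; map′; ¬?; _×-dec_; _⊎-dec_; _→-dec_)
open import Relation.Nullary.Negation using (¬_; contradiction)
open import Relation.Unary using (Pred; Decidable)

open import Algebra.Properties.CommutativeMonoid.Sum +-0-commutativeMonoid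
  using (sum; sum-cong-≗)

record Graph : Set₁ where
  infix 4 _∼_ _∼?_
  field
    V        : Set
    order    : ℕ
    finite   : V ↔ Fin order
    _∼_      : Rel V 0ℓ
    _∼?_     : Decidable₂ _∼_
    ∼-sym    : Symmetric _∼_
    ∼-irrefl : Irreflexive _≡_ _∼_

  index : V → Fin order
  index = Inverse.to finite

  vertex : Fin order → V
  vertex = Inverse.from finite

  vertex-index : ∀ v → vertex (index v) ≡ v
  vertex-index = Inverse.strictlyInverseʳ finite

  _≟_ : DecidableEquality V
  u ≟ v = map′ (λ eq → trans (sym (vertex-index u)) (trans (cong vertex eq) (vertex-index v)))
               (cong index) (index u ≟ᶠ index v)

  ∑ : (V → ℕ) → ℕ
  ∑ g = sum (g ∘ vertex)

  VSet : Set
  VSet = V → Bool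

  infix 4 _∈_ _∉_
  _∈_ : V → VSet → Set
  v ∈ S = S v ≡ true

  _∉_ : V → VSet → Set
  v ∉ S = ¬ (v ∈ S)

  ∣_∣ : VSet → ℕ
  ∣ S ∣ = ∑ (λ v → if S v then 1 else 0)

  N : V → VSet
  N v u = does (v ∼? u)

  degree : V → ℕ
  degree v = ∣ N v ∣

  Δ : ℕ
  Δ = max 0 (tabulate (degree ∘ vertex))

  Nontrivial : Set
  Nontrivial = 2 ≤ order

  NoIsolated : Set
  NoIsolated = ∀ v → ∃[ u ] v ∼ u

infixr 7 _⊚_

-- The lexicographic product G ∘ H; the symbol ∘ is taken by composition.
_⊚_ : Graph → Graph → Graph
G ⊚ H = record
  { V        = G.V × H.V
  ; order    = G.order * H.order
  ; finite   = ↔-sym *↔× ↔-∘ (G.finite ×-↔ H.finite)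
  ; _∼_      = λ (u , v) (x , y) → u G.∼ x ⊎ (u ≡ x × v H.∼ y)
  ; _∼?_     = λ (u , v) (x , y) → (u G.∼? x) ⊎-dec ((u G.≟ x) ×-dec (v H.∼? y))
  ; ∼-sym    = λ { (inj₁ ux) → inj₁ (G.∼-sym ux)
                 ; (inj₂ (u≡x , vy)) → inj₂ (sym u≡x , H.∼-sym vy) }
  ; ∼-irrefl = λ { refl (inj₁ uu) → G.∼-irrefl refl uu
                 ; refl (inj₂ (_ , vv)) → H.∼-irrefl refl vv }
  }
  where
  module G = Graph G
  module H = Graph H

IsMinimum : {X : Set} → Pred X 0ℓ → (X → ℕ) → ℕ → Set
IsMinimum P w k = (∃[ x ] P x × w x ≡ k) × (∀ x → P x → k ≤ w x)

-- In the absence of function extensionality, exhaustive search over a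
-- function space only decides predicates that respect pointwise equality.
Searchable : (X : Set) → Rel X 0ℓ → Set₁
Searchable X _≈_ =
  (Q : Pred X 0ℓ) → (∀ {x y} → x ≈ y → Q x → Q y) → Decidable Q → Dec (∃ Q)

minimum : {X : Set} {_≈_ : Rel X 0ℓ} → Searchable X _≈_ →
          (P : Pred X 0ℓ) → (∀ {x y} → x ≈ y → P x → P y) → Decidable P →
          (w : X → ℕ) → (∀ {x y} → x ≈ y → w x ≡ w y) →
          ∃ P → ∃[ k ] IsMinimum P w k
minimum {X} search P P-resp P? w w-resp (x₀ , p₀) =
  <-rec Goal step (w x₀) x₀ p₀ refl
  where
  Goal : ℕ → Set
  Goal k = ∀ x → P x → w x ≡ k → ∃ (IsMinimum P w)

  step : ∀ k → (∀ {j} → j < k → Goal j) → Goal k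
  step k rec x p eq
    with search (λ y → P y × w y < k)
                (λ x≈y (q , lt) → P-resp x≈y q , subst (_< k) (w-resp x≈y) lt)
                (λ y → P? y ×-dec (w y <? k))
  ... | yes (y , q , lt) = rec lt y q refl
  ... | no none = k , (x , p , eq) , λ y q → ≮⇒≥ (λ lt → none (y , q , lt))

search-× : {X Y : Set} {_≈₁_ : Rel X 0ℓ} {_≈₂_ : Rel Y 0ℓ} →
           (∀ {x} → x ≈₁ x) → (∀ {y} → y ≈₂ y) →
           Searchable X _≈₁_ → Searchable Y _≈₂_ →
           Searchable (X × Y) (λ (x , y) (x′ , y′) → x ≈₁ x′ × y ≈₂ y′)
search-× refl₁ refl₂ s₁ s₂ Q resp Q? =
  map′ (λ (x , y , q) → (x , y) , q) (λ ((x , y) , q) → x , y , q)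
    (s₁ (λ x → ∃[ y ] Q (x , y))
        (λ x≈x′ (y , q) → y , resp (x≈x′ , refl₂) q)
        (λ x → s₂ (λ y → Q (x , y)) (λ y≈y′ → resp (refl₁ , y≈y′)) (λ y → Q? (x , y))))

module _ (G : Graph) where
  open Graph G

  allV? : {Q : Pred V 0ℓ} → Decidable Q → Dec (∀ v → Q v)
  allV? {Q} Q? = map′ (λ h v → subst Q (vertex-index v) (h (index v))) (_∘ vertex)
                      (all? (Q? ∘ vertex))

  anyV? : {Q : Pred V 0ℓ} → Decidable Q → Dec (∃ Q)
  anyV? {Q} Q? = map′ (λ (i , q) → vertex i , q)
                      (λ (v , q) → index v , subst Q (sym (vertex-index v)) q)
                      (any? (Q? ∘ vertex))

  search-→ : {C : Set} {c : ℕ} → C ↔ Fin c → Searchable (V → C) _≗_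
  search-→ {C} {c} C↔ Q resp Q? =
    map′ (λ (i , q) → decode i , q)
         (λ (f , q) → encode f , resp (λ v → sym (decode-encode f v)) q)
         (any? (Q? ∘ decode))
    where
    module C = Inverse C↔

    decode : Fin (c ^ order) → V → C
    decode i v = C.from (finToFun i (index v))

    encode : (V → C) → Fin (c ^ order)
    encode f = funToFin (C.to ∘ f ∘ vertex)

    decode-encode : ∀ f → decode (encode f) ≗ f
    decode-encode f v =
      trans (cong C.from (finToFun-funToFin (C.to ∘ f ∘ vertex) (index v)))
            (trans (C.strictlyInverseʳ _) (cong f (vertex-index v)))

  search-VSet : Searchable VSet _≗_
  search-VSet = search-→ (↔-sym 2↔Bool)

  ∑-cong : {g h : V → ℕ} → g ≗ h → ∑ g ≡ ∑ h
  ∑-cong g≗h = sum-cong-≗ (g≗h ∘ vertex)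

  ∣∣-cong : {S T : VSet} → S ≗ T → ∣ S ∣ ≡ ∣ T ∣
  ∣∣-cong S≗T = ∑-cong (λ v → cong (if_then 1 else 0) (S≗T v))

  ∈-resp : {S T : VSet} → S ≗ T → ∀ {v} → v ∈ S → v ∈ T
  ∈-resp S≗T {v} = trans (sym (S≗T v))

  ∉-resp : {S T : VSet} → S ≗ T → ∀ {v} → v ∉ T → v ∉ S
  ∉-resp S≗T v∉T v∈S = v∉T (∈-resp S≗T v∈S)

  _∈?_ : ∀ v (S : VSet) → Dec (v ∈ S)
  v ∈? S = S v ≟ᵇ true

  Dominating : VSet → Set
  Dominating S = ∀ v → v ∉ S → ∃[ u ] v ∼ u × u ∈ S

  γ-minimum : ∃[ k ] IsMinimum Dominating ∣_∣ k
  γ-minimum = minimum search-VSet Dominating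
    (λ S≗T dom v v∉T → let (u , vu , u∈S) = dom v (∉-resp S≗T v∉T)
                       in u , vu , ∈-resp S≗T u∈S)
    (λ S → allV? λ v → ¬? (v ∈? S) →-dec anyV? λ u → (v ∼? u) ×-dec (u ∈? S))
    ∣_∣ ∣∣-cong
    (const true , λ v v∉ → contradiction refl v∉)

  γ : ℕ
  γ = proj₁ γ-minimum

  TotalDominating : VSet → Set
  TotalDominating S = ∀ v → ∃[ u ] v ∼ u × u ∈ S

  γₜ-minimum : NoIsolated → ∃[ k ] IsMinimum TotalDominating ∣_∣ k
  γₜ-minimum noIso = minimum search-VSet TotalDominating
    (λ S≗T dom v → let (u , vu , u∈S) = dom v in u , vu , ∈-resp S≗T u∈S)
    (λ S → allV? λ v → anyV? λ u → (v ∼? u) ×-dec (u ∈? S))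
    ∣_∣ ∣∣-cong
    (const true , λ v → let (u , vu) = noIso v in u , vu , refl)

  γₜ : NoIsolated → ℕ
  γₜ noIso = proj₁ (γₜ-minimum noIso)

  RomanDominating : (V → Fin 3) → Set
  RomanDominating f = ∀ u → f u ≡ 0F → ∃[ v ] u ∼ v × f v ≡ 2F

  weight : (V → Fin 3) → ℕ
  weight f = ∑ (toℕ ∘ f)

  γR-minimum : ∃[ k ] IsMinimum RomanDominating weight k
  γR-minimum = minimum (search-→ (↔-id (Fin 3))) RomanDominating
    (λ f≗g dom u gu≡0 → let (v , uv , fv≡2) = dom u (trans (f≗g u) gu≡0)
                        in v , uv , trans (sym (f≗g v)) fv≡2)
    (λ f → allV? λ u → (f u ≟ᶠ 0F) →-dec anyV? λ v → (u ∼? v) ×-dec (f v ≟ᶠ 2F))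
    weight (λ f≗g → ∑-cong (λ v → cong toℕ (f≗g v)))
    (const 2F , λ u ())

  γR : ℕ
  γR = proj₁ γR-minimum

  Disjoint : VSet → VSet → Set
  Disjoint A B = ∀ v → ¬ (v ∈ A × v ∈ B)

  DominatingCouple : VSet × VSet → Set
  DominatingCouple (A , B) =
    Disjoint A B × (∀ x → x ∉ B → ∃[ y ] x ∼ y × (y ∈ A ⊎ y ∈ B))

  coupleCost : VSet × VSet → ℕ
  coupleCost (A , B) = 2 * ∣ A ∣ + 3 * ∣ B ∣

  ζ-minimum : ∃[ k ] IsMinimum DominatingCouple coupleCost k
  ζ-minimum = minimum
    (search-× {_≈₁_ = _≗_} {_≈₂_ = _≗_} (λ _ → refl) (λ _ → refl) search-VSet search-VSet)
    DominatingCouple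
    (λ { {A , B} {A′ , B′} (A≗A′ , B≗B′) (disj , dom) →
         (λ v (v∈A′ , v∈B′) → disj v ( ∈-resp (sym ∘ A≗A′) v∈A′
                                     , ∈-resp (sym ∘ B≗B′) v∈B′))
       , (λ x x∉B′ → case⊎ A≗A′ B≗B′ (dom x (∉-resp B≗B′ x∉B′))) })
    (λ (A , B) →
      allV? (λ v → ¬? ((v ∈? A) ×-dec (v ∈? B))) ×-dec
      allV? (λ x → ¬? (x ∈? B) →-dec
        anyV? λ y → (x ∼? y) ×-dec ((y ∈? A) ⊎-dec (y ∈? B))))
    coupleCost
    (λ (A≗A′ , B≗B′) → cong₂ (λ a b → 2 * a + 3 * b) (∣∣-cong A≗A′) (∣∣-cong B≗B′))
    ((const false , const true) , (λ { v (() , _) }) , λ x x∉ → contradiction refl x∉)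
    where
    case⊎ : ∀ {A A′ B B′ x} → A ≗ A′ → B ≗ B′ →
            ∃[ y ] x ∼ y × (y ∈ A ⊎ y ∈ B) → ∃[ y ] x ∼ y × (y ∈ A′ ⊎ y ∈ B′)
    case⊎ A≗A′ B≗B′ (y , xy , inj₁ y∈A) = y , xy , inj₁ (∈-resp A≗A′ y∈A)
    case⊎ A≗A′ B≗B′ (y , xy , inj₂ y∈B) = y , xy , inj₂ (∈-resp B≗B′ y∈B)

  ζ : ℕ
  ζ = proj₁ ζ-minimum

{-# OPTIONS --safe #-}
module Submission where

-- A Roman dominating function f of G ∘ H is judged by the weights W u of its
-- columns {u} × H. Columns with W u ≥ 2 contain all the 2s, and a column of weight
-- at most 1 must be defended from a neighbouring column. When Δ(H) ≤ |H| − k with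
-- k ≤ 3, so must every column of weight at most k that contains a 2. The columns
-- with 2 ≤ W u ≤ k and no neighbour of weight ≥ 2 then contain no 2; replacing
-- each of them by a neighbour costs nothing and repairs the domination. For k = 3
-- every column of weight ≥ 4 pays for a neighbour of its own, giving a total
-- dominating set; for k = 2 the columns of weight ≥ 3 form B, the others A.

open import Defs
open import Data.Bool.Base using (Bool; true; false; if_then_else_; _∧_; _∨_)
open import Data.Fin.Base using (Fin; zero; suc; toℕ; fromℕ<; combine; _↑ˡ_; _↑ʳ_)
open import Data.Fin.Patterns using (0F; 1F; 2F)
open import Data.Fin.Properties using (remQuot-combine) renaming (_≟_ to _≟ᶠ_)
open import Data.List.Base using (tabulate)
open import Data.List.Extrema.Nat using (argmax-sel; xs≤max)
open import Data.List.Membership.Propositional.Properties using (∈-tabulate⁻)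
open import Data.List.Relation.Unary.All.Properties using (tabulate⁻)
open import Data.Nat.Base using (ℕ; zero; suc; _+_; _*_; _≤_; _<_; z≤n; s≤s; s≤s⁻¹)
open import Data.Nat.Properties hiding (_≟_)
open import Data.Product.Base using (∃-syntax; _×_; _,_; proj₁; proj₂)
open import Data.Sum.Base using (_⊎_; inj₁; inj₂)
open import Function.Base using (_∘_; const; id; case_of_)
open import Function.Bundles using (Inverse)
open import Relation.Binary.PropositionalEquality
open import Relation.Nullary.Decidable
  using (Dec; yes; no; does; ¬?; _×-dec_; _⊎-dec_; _→-dec_; dec-true)
open import Relation.Nullary.Negation using (¬_; contradiction)
open import Relation.Unary using (Decidable)

open import Algebra.Properties.CommutativeMonoid.Sum +-0-commutativeMonoid
  using (sum; sum-cong-≗; ∑-distrib-+; ∑-comm; sum-replicate-zero)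
open import Algebra.Properties.Semiring.Sum +-*-semiring using (*-distribˡ-sum)

-- Finite sums and indicators

sum-mono : ∀ {n} {f g : Fin n → ℕ} → (∀ i → f i ≤ g i) → sum f ≤ sum g
sum-mono {zero}  f≤g = z≤n
sum-mono {suc n} f≤g = +-mono-≤ (f≤g zero) (sum-mono (f≤g ∘ suc))

sum-const-1 : ∀ n → sum {n} (const 1) ≡ n
sum-const-1 zero    = refl
sum-const-1 (suc n) = cong suc (sum-const-1 n)

sum-↑ : ∀ m {n} (f : Fin (m + n) → ℕ) →
        sum f ≡ sum (f ∘ (_↑ˡ n)) + sum (f ∘ (m ↑ʳ_))
sum-↑ zero    f = refl
sum-↑ (suc m) f = trans (cong (f zero +_) (sum-↑ m (f ∘ suc)))
                        (sym (+-assoc (f zero) _ _))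

sum-combine : ∀ m {n} (f : Fin (m * n) → ℕ) →
              sum f ≡ sum (λ (i : Fin m) → sum (λ (j : Fin n) → f (combine i j)))
sum-combine zero        f = refl
sum-combine (suc m) {n} f =
  trans (sum-↑ n f) (cong (sum (f ∘ (_↑ˡ (m * n))) +_) (sum-combine m (f ∘ (n ↑ʳ_))))

𝟙 : {P : Set} → Dec P → ℕ
𝟙 P? = if does P? then 1 else 0

𝟙-yes : {P : Set} (P? : Dec P) → P → 𝟙 P? ≡ 1
𝟙-yes (yes _) p = refl
𝟙-yes (no ¬p) p = contradiction p ¬p

𝟙-≤ : {P : Set} (P? : Dec P) {n : ℕ} → (P → 1 ≤ n) → 𝟙 P? ≤ n
𝟙-≤ (yes p) le = le p
𝟙-≤ (no _)  le = z≤n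

𝟙-⊎ : {P Q : Set} (P? : Dec P) (Q? : Dec Q) → 𝟙 (P? ⊎-dec Q?) ≤ 𝟙 P? + 𝟙 Q?
𝟙-⊎ (yes _) Q? = s≤s z≤n
𝟙-⊎ (no _)  Q? = ≤-refl

does⇒ : {P : Set} (P? : Dec P) → does P? ≡ true → P
does⇒ (yes p) _ = p

sum-𝟙-≟ : ∀ {n} (j : Fin n) → sum (λ i → 𝟙 (j ≟ᶠ i)) ≡ 1
sum-𝟙-≟ {suc n} zero    = cong suc (sum-replicate-zero n)
sum-𝟙-≟ {suc n} (suc j) = sum-𝟙-≟ j

-- Sums over the vertices of a graph

module _ (G : Graph) where
  open Graph G

  ∑-mono : {f g : V → ℕ} → (∀ v → f v ≤ g v) → ∑ f ≤ ∑ g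
  ∑-mono f≤g = sum-mono (f≤g ∘ vertex)

  ∑-+ : (f g : V → ℕ) → ∑ (λ v → f v + g v) ≡ ∑ f + ∑ g
  ∑-+ f g = ∑-distrib-+ (f ∘ vertex) (g ∘ vertex)

  ∑-* : (c : ℕ) (f : V → ℕ) → ∑ (λ v → c * f v) ≡ c * ∑ f
  ∑-* c f = sym (*-distribˡ-sum c (f ∘ vertex))

  ∑-1 : ∑ (const 1) ≡ order
  ∑-1 = sum-const-1 order

  ∑-point : ∀ v → ∑ (λ u → 𝟙 (v ≟ u)) ≡ 1
  ∑-point v = trans
    -- Equality of vertices is decided by comparing indices, so each indicator reduces to one on
    -- `Fin order`.
    (sum-cong-≗ λ i → cong (λ j → 𝟙 (index v ≟ᶠ j)) (Inverse.strictlyInverseˡ finite i))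
    (sum-𝟙-≟ (index v))

  ∑-*-point : ∀ c v → ∑ (λ u → c * 𝟙 (v ≟ u)) ≡ c
  ∑-*-point c v = trans (∑-* c (λ u → 𝟙 (v ≟ u))) (trans (cong (c *_) (∑-point v)) (*-identityʳ c))

  -- The value `f v` is itself the sum of a function concentrated at `v`, so a pointwise comparison
  -- suffices.
  term≤∑ : (f : V → ℕ) → ∀ v → f v ≤ ∑ f
  term≤∑ f v = subst (_≤ ∑ f) (∑-*-point (f v) v) (∑-mono λ u → pointwise u (v ≟ u))
    where
    pointwise : ∀ u (v≟u : Dec (v ≡ u)) → f v * 𝟙 v≟u ≤ f u
    pointwise u (yes refl) = ≤-reflexive (*-identityʳ (f v))
    pointwise u (no _)     = ≤-trans (≤-reflexive (*-zeroʳ (f v))) z≤n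

  two-terms≤∑ : (f : V → ℕ) → ∀ {u v} → u ≢ v → f u + f v ≤ ∑ f
  two-terms≤∑ f {u} {v} u≢v = subst (_≤ ∑ f)
    (trans (∑-+ (λ x → f u * 𝟙 (u ≟ x)) (λ x → f v * 𝟙 (v ≟ x)))
           (cong₂ _+_ (∑-*-point (f u) u) (∑-*-point (f v) v)))
    (∑-mono λ x → pointwise x (u ≟ x) (v ≟ x))
    where
    pointwise : ∀ x (u≟x : Dec (u ≡ x)) (v≟x : Dec (v ≡ x)) →
                f u * 𝟙 u≟x + f v * 𝟙 v≟x ≤ f x
    pointwise x (yes refl) (yes refl) = contradiction refl u≢v
    pointwise x (yes refl) (no _) rewrite *-zeroʳ (f v) | *-identityʳ (f u) =
      ≤-reflexive (+-identityʳ (f u))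
    pointwise x (no _) (yes refl) rewrite *-zeroʳ (f u) = ≤-reflexive (*-identityʳ (f v))
    pointwise x (no _) (no _) rewrite *-zeroʳ (f u) | *-zeroʳ (f v) = z≤n

  Image : (V → V) → (V → Set) → (V → Set)
  Image c P v = ∃[ x ] P x × c x ≡ v

  image? : (c : V → V) {P : V → Set} → Decidable P → Decidable (Image c P)
  image? c P? v = anyV? G λ x → P? x ×-dec (c x ≟ v)

  -- Double counting: each vertex of the image is charged to a preimage satisfying `P`, and each
  -- such preimage is charged by its own image only.
  ∑-image : (c : V → V) {P : V → Set} (P? : Decidable P) →
            ∑ (λ v → 𝟙 (image? c P? v)) ≤ ∑ (λ x → 𝟙 (P? x))
  ∑-image c {P} P? = begin
    ∑ (λ v → 𝟙 (image? c P? v))                ≤⟨ ∑-mono pointwise ⟩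
    ∑ (λ v → ∑ (λ x → 𝟙 (P? x) * 𝟙 (c x ≟ v))) ≡⟨ ∑-comm {order} {order} _ ⟩
    ∑ (λ x → ∑ (λ v → 𝟙 (P? x) * 𝟙 (c x ≟ v))) ≡⟨ ∑-cong G (λ x → ∑-*-point (𝟙 (P? x)) (c x)) ⟩
    ∑ (λ x → 𝟙 (P? x))                         ∎
    where
    open ≤-Reasoning

    pointwise : ∀ v → 𝟙 (image? c P? v) ≤ ∑ (λ x → 𝟙 (P? x) * 𝟙 (c x ≟ v))
    pointwise v = 𝟙-≤ (image? c P? v) λ (x , p , cx≡v) →
      ≤-trans (≤-reflexive (sym (cong₂ _*_ (𝟙-yes (P? x) p) (𝟙-yes (c x ≟ v) cx≡v))))
              (term≤∑ (λ x → 𝟙 (P? x) * 𝟙 (c x ≟ v)) x)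

  -- This lets the size of a set that is partly kept and partly replaced by neighbours be paid for
  -- column by column.
  ∑-⊎-image : (c : V → V) {P Q : V → Set} (Q? : Decidable Q) (P? : Decidable P) →
              ∑ (λ v → 𝟙 (Q? v ⊎-dec image? c P? v)) ≤ ∑ (λ v → 𝟙 (Q? v) + 𝟙 (P? v))
  ∑-⊎-image c Q? P? = begin
    ∑ (λ v → 𝟙 (Q? v ⊎-dec image? c P? v))
      ≤⟨ ∑-mono (λ v → 𝟙-⊎ (Q? v) (image? c P? v)) ⟩
    ∑ (λ v → 𝟙 (Q? v) + 𝟙 (image? c P? v))
      ≡⟨ ∑-+ (λ v → 𝟙 (Q? v)) (λ v → 𝟙 (image? c P? v)) ⟩
    ∑ (λ v → 𝟙 (Q? v)) + ∑ (λ v → 𝟙 (image? c P? v))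
      ≤⟨ +-monoʳ-≤ (∑ (λ v → 𝟙 (Q? v))) (∑-image c P?) ⟩
    ∑ (λ v → 𝟙 (Q? v)) + ∑ (λ v → 𝟙 (P? v))
      ≡⟨ ∑-+ (λ v → 𝟙 (Q? v)) (λ v → 𝟙 (P? v)) ⟨
    ∑ (λ v → 𝟙 (Q? v) + 𝟙 (P? v)) ∎
    where open ≤-Reasoning

  -- Maximum degree and nearly universal vertices

  degree≤Δ : ∀ v → degree v ≤ Δ
  degree≤Δ v = subst (λ u → degree u ≤ Δ) (vertex-index v)
    (tabulate⁻ (xs≤max 0 (tabulate (degree ∘ vertex))) (index v))

  -- The maximum is taken with default 0. When the default is what is selected, the supplied vertex
  -- has degree 0 and attains it.
  Δ-attained : V → ∃[ v ] degree v ≡ Δ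
  Δ-attained v with argmax-sel id 0 (tabulate (degree ∘ vertex))
  ... | inj₁ Δ≡0 = v , ≤-antisym (degree≤Δ v) (≤-trans (≤-reflexive Δ≡0) z≤n)
  ... | inj₂ Δ∈  = let (i , Δ≡) = ∈-tabulate⁻ Δ∈ in vertex i , sym Δ≡

  Apart : V → V → Set
  Apart h v = h ≢ v × ¬ h ∼ v

  apart? : ∀ h → Decidable (Apart h)
  apart? h v = ¬? (h ≟ v) ×-dec ¬? (h ∼? v)

  -- Every vertex is exactly one of: a neighbour of `h`, `h` itself, or apart from `h`.
  degree+apart : ∀ h → degree h + suc (∑ (λ v → 𝟙 (apart? h v))) ≡ order
  degree+apart h = begin
    degree h + suc (∑ apart)            ≡⟨ cong (λ k → degree h + (k + ∑ apart)) (∑-point h) ⟨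
    degree h + (∑ point + ∑ apart)      ≡⟨ cong (degree h +_) (∑-+ point apart) ⟨
    degree h + ∑ (λ v → point v + apart v) ≡⟨ ∑-+ near (λ v → point v + apart v) ⟨
    ∑ (λ v → near v + (point v + apart v)) ≡⟨ ∑-cong G (λ v → pointwise v (h ∼? v) (h ≟ v)) ⟩
    ∑ (const 1)                         ≡⟨ ∑-1 ⟩
    order                               ∎
    where
    open ≡-Reasoning

    near point apart : V → ℕ
    near v  = 𝟙 (h ∼? v)
    point v = 𝟙 (h ≟ v)
    apart v = 𝟙 (apart? h v)

    pointwise : ∀ v (h∼?v : Dec (h ∼ v)) (h≟v : Dec (h ≡ v)) →
                𝟙 h∼?v + (𝟙 h≟v + 𝟙 (¬? h≟v ×-dec ¬? h∼?v)) ≡ 1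
    pointwise v (yes h∼v) (yes h≡v) = contradiction h∼v (∼-irrefl h≡v)
    pointwise v (yes _)   (no _)    = refl
    pointwise v (no _)    (yes _)   = refl
    pointwise v (no _)    (no _)    = refl

  apart-count : ∀ {h k} → degree h + suc k ≡ order → ∑ (λ v → 𝟙 (apart? h v)) ≡ k
  apart-count {h} deg = suc-injective
    (+-cancelˡ-≡ (degree h) _ _ (trans (degree+apart h) (sym deg)))

  closed-or-apart : ∀ h v → (v ≡ h ⊎ h ∼ v) ⊎ Apart h v
  closed-or-apart h v with h ≟ v | h ∼? v
  ... | yes h≡v | _       = inj₁ (inj₁ (sym h≡v))
  ... | no _    | yes h∼v = inj₁ (inj₂ h∼v)
  ... | no h≢v  | no h≁v  = inj₂ (h≢v , h≁v)

  universal : ∀ {h} → degree h + 1 ≡ order → ∀ v → v ≡ h ⊎ h ∼ v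
  universal {h} deg v with closed-or-apart h v
  ... | inj₁ near  = near
  ... | inj₂ apart = contradiction
    (≤-trans (≤-reflexive (sym (𝟙-yes (apart? h v) apart)))
             (≤-trans (term≤∑ (λ v → 𝟙 (apart? h v)) v) (≤-reflexive (apart-count deg))))
    λ ()

  -- Exactly one vertex is apart from `h`: a count of 1 excludes both none and two distinct ones.
  -- The exceptional vertex later receives the value 1.
  almost-universal : ∀ {h} → degree h + 2 ≡ order →
                     ∃[ h′ ] ∀ v → (v ≡ h ⊎ h ∼ v) ⊎ v ≡ h′
  almost-universal {h} deg with anyV? G (apart? h)
  ... | no none = contradiction
    (trans (sym (apart-count deg)) (trans (∑-cong G (λ v → zero-at v (apart? h v))) (sum-replicate-zero order)))
    λ ()
    where
    zero-at : ∀ v (a? : Dec (Apart h v)) → 𝟙 a? ≡ 0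
    zero-at v (yes a) = contradiction (v , a) none
    zero-at v (no _)  = refl
  ... | yes (h′ , apart′) = h′ , λ v → near v (closed-or-apart h v) (v ≟ h′)
    where
    near : ∀ v → (v ≡ h ⊎ h ∼ v) ⊎ Apart h v → Dec (v ≡ h′) → (v ≡ h ⊎ h ∼ v) ⊎ v ≡ h′
    near v (inj₁ n)     _          = inj₁ n
    near v (inj₂ _)     (yes v≡h′) = inj₂ v≡h′
    near v (inj₂ apart) (no v≢h′)  = contradiction
      (≤-trans (≤-reflexive (sym (cong₂ _+_ (𝟙-yes (apart? h v) apart)
                                            (𝟙-yes (apart? h h′) apart′))))
               (≤-trans (two-terms≤∑ (λ v → 𝟙 (apart? h v)) v≢h′) (≤-reflexive (apart-count deg))))
      λ { (s≤s ()) }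

-- Applied to the parameters of `G`, this reduces upper bounds on `γR` to constructions from one
-- given set or couple; applied to `γR`, it reduces lower bounds to the study of one given function.
attained-≤ : {X : Set} {P : X → Set} {w : X → ℕ} {k m : ℕ} (c : ℕ → ℕ) →
             IsMinimum P w k → (∀ x → P x → m ≤ c (w x)) → m ≤ c k
attained-≤ c ((x , p , refl) , _) bound = bound x p

γR-≤ : (Γ : Graph) (f : Graph.V Γ → Fin 3) → RomanDominating Γ f → γR Γ ≤ weight Γ f
γR-≤ Γ f = proj₂ (proj₂ (γR-minimum Γ)) f

-- The lexicographic product and its columns

module _ (G H : Graph) where
  private
    module G  = Graph G
    module H  = Graph H
    module GH = Graph (G ⊚ H)

  -- Vertices of the product are indexed through `combine`, whose consecutive blocks are the
  -- columns.
  ∑-⊚ : (g : GH.V → ℕ) → GH.∑ g ≡ G.∑ (λ u → H.∑ (λ v → g (u , v)))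
  ∑-⊚ g = trans (sum-combine G.order _)
    (sum-cong-≗ λ i → sum-cong-≗ λ j →
      cong (λ (i , j) → g (G.vertex i , H.vertex j)) (remQuot-combine i j))

  -- Upper bounds: a Roman dominating function from a couple

  module _ {A B : G.VSet} {h₀ h₁ : H.V} where

    private
      -- The arguments stand for `u ∈ A`, `u ∈ B`, `v ≡ h₀` and `v ≡ h₁`. A column over `A` is meant
      -- to cost 2, and one over `B` to cost 3.
      value : (a b x y : Bool) → Fin 3
      value a b x y = if (a ∨ b) ∧ x then 2F else if b ∧ y then 1F else 0F

      -- The right side is linear in the indicators of `h₀` and `h₁`, so its column sums come from
      -- point masses. It may overestimate, for instance when `h₀` and `h₁` coincide, which an upper
      -- bound tolerates.
      toℕ-value : ∀ a b x y → toℕ (value a b x y) ≤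
        2 * (if a then 1 else 0) * (if x then 1 else 0) +
        ((if b then 1 else 0) * (if y then 1 else 0) +
         2 * (if b then 1 else 0) * (if x then 1 else 0))
      toℕ-value false false x     y     = z≤n
      toℕ-value false true  false false = z≤n
      toℕ-value false true  false true  = ≤-refl
      toℕ-value false true  true  false = ≤-refl
      toℕ-value false true  true  true  = s≤s (s≤s z≤n)
      toℕ-value true  false true  y     = ≤-refl
      toℕ-value true  false false y     = z≤n
      toℕ-value true  true  true  y     = s≤s (s≤s z≤n)
      toℕ-value true  true  false false = z≤n
      toℕ-value true  true  false true  = ≤-refl

      value-∈ : ∀ {a b x} y → a ≡ true ⊎ b ≡ true → x ≡ true → value a b x y ≡ 2F
      value-∈ {true}          y _         refl = refl
      value-∈ {false} {true}  y _         refl = refl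
      value-∈ {false} {false} y (inj₁ ()) _
      value-∈ {false} {false} y (inj₂ ()) _

      value-≢0 : ∀ a {b} x {y} → b ≡ true → y ≡ true → value a b x y ≢ 0F
      value-≢0 true  true  refl refl ()
      value-≢0 true  false refl refl ()
      value-≢0 false true  refl refl ()
      value-≢0 false false refl refl ()

      roman : GH.V → Fin 3
      roman (u , v) = value (A u) (B u) (does (h₀ H.≟ v)) (does (h₁ H.≟ v))

      roman-h₀ : ∀ {u} → A u ≡ true ⊎ B u ≡ true → roman (u , h₀) ≡ 2F
      roman-h₀ u∈ = value-∈ _ u∈ (dec-true (h₀ H.≟ h₀) refl)

      roman-weight : weight (G ⊚ H) roman ≤ coupleCost G (A , B)
      roman-weight = begin
        weight (G ⊚ H) roman ≡⟨ ∑-⊚ (toℕ ∘ roman) ⟩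
        G.∑ (λ u → H.∑ (λ v → toℕ (roman (u , v))))
          ≤⟨ ∑-mono G (λ u → ∑-mono H (λ v →
               toℕ-value (A u) (B u) (does (h₀ H.≟ v)) (does (h₁ H.≟ v)))) ⟩
        G.∑ (λ u → H.∑ (λ v → 2 * a u * 𝟙 (h₀ H.≟ v) +
                              (b u * 𝟙 (h₁ H.≟ v) + 2 * b u * 𝟙 (h₀ H.≟ v))))
          ≡⟨ ∑-cong G (λ u → column (a u) (b u)) ⟩
        G.∑ (λ u → 2 * a u + 3 * b u) ≡⟨ ∑-+ G (λ u → 2 * a u) (λ u → 3 * b u) ⟩
        G.∑ (λ u → 2 * a u) + G.∑ (λ u → 3 * b u) ≡⟨ cong₂ _+_ (∑-* G 2 a) (∑-* G 3 b) ⟩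
        coupleCost G (A , B) ∎
        where
        open ≤-Reasoning

        a b : G.V → ℕ
        a u = if A u then 1 else 0
        b u = if B u then 1 else 0

        column : ∀ a b → H.∑ (λ v → 2 * a * 𝟙 (h₀ H.≟ v) +
                                    (b * 𝟙 (h₁ H.≟ v) + 2 * b * 𝟙 (h₀ H.≟ v)))
                         ≡ 2 * a + 3 * b
        column a b =
          trans (∑-+ H (λ v → 2 * a * 𝟙 (h₀ H.≟ v))
                       (λ v → b * 𝟙 (h₁ H.≟ v) + 2 * b * 𝟙 (h₀ H.≟ v)))
          (cong₂ _+_ (∑-*-point H (2 * a) h₀)
            (trans (∑-+ H (λ v → b * 𝟙 (h₁ H.≟ v)) (λ v → 2 * b * 𝟙 (h₀ H.≟ v)))
                   (cong₂ _+_ (∑-*-point H b h₁) (∑-*-point H (2 * b) h₀))))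

    -- The alternatives are the ways to satisfy `(u , v)`: a 2 in a neighbouring column, the 2 at
    -- `h₀` in its own column, or a positive value of its own at `h₁`.
    γR-≤-coupleCost :
      (∀ u v → (∃[ y ] u G.∼ y × (y G.∈ A ⊎ y G.∈ B))
             ⊎ ((u G.∈ A ⊎ u G.∈ B) × (v ≡ h₀ ⊎ h₀ H.∼ v))
             ⊎ (u G.∈ B × v ≡ h₁)) →
      γR (G ⊚ H) ≤ coupleCost G (A , B)
    γR-≤-coupleCost covered = ≤-trans (γR-≤ (G ⊚ H) roman dominating) roman-weight
      where
      dominating : RomanDominating (G ⊚ H) roman
      dominating (u , v) ≡0 with covered u v
      ... | inj₁ (y , u∼y , y∈)                = (y , h₀) , inj₁ u∼y , roman-h₀ y∈
      ... | inj₂ (inj₁ (u∈ , inj₂ h₀∼v))       = (u , h₀) , inj₂ (refl , H.∼-sym h₀∼v) , roman-h₀ u∈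
      ... | inj₂ (inj₁ (u∈ , inj₁ refl))       = contradiction (trans (sym ≡0) (roman-h₀ u∈)) λ ()
      ... | inj₂ (inj₂ (u∈B , refl))           =
        contradiction ≡0 (value-≢0 (A u) _ u∈B (dec-true (h₁ H.≟ h₁) refl))

  -- Lower bounds: the columns of a Roman dominating function

  module _ (f : GH.V → Fin 3) (dom : RomanDominating (G ⊚ H) f) where

    private
      W : G.V → ℕ
      W u = H.∑ (λ v → toℕ (f (u , v)))

      ∑-W : G.∑ W ≡ weight (G ⊚ H) f
      ∑-W = sym (∑-⊚ (toℕ ∘ f))

    -- Neighbouring columns are completely joined in the product, so a single 2 in one of them
    -- serves the whole column of `u`.
    Defended : G.V → Set
    Defended u = ∃[ y ] u G.∼ y × ∃[ v ] f (y , v) ≡ 2F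

    defended? : ∀ u → Dec (Defended u)
    defended? u = anyV? G λ y → (u G.∼? y) ×-dec anyV? H λ v → f (y , v) ≟ᶠ 2F

    2≤W : ∀ {u v} → f (u , v) ≡ 2F → 2 ≤ W u
    2≤W {u} {v} ≡2 = ≤-trans (≤-reflexive (cong toℕ (sym ≡2))) (term≤∑ H (λ v → toℕ (f (u , v))) v)

    undefended-zero : ∀ {u v} → ¬ Defended u → f (u , v) ≡ 0F → ∃[ v′ ] v H.∼ v′ × f (u , v′) ≡ 2F
    undefended-zero ¬def ≡0 with dom _ ≡0
    ... | (y , v′) , inj₁ u∼y , ≡2           = contradiction (y , u∼y , v′ , ≡2) ¬def
    ... | (_ , v′) , inj₂ (refl , v∼v′) , ≡2 = v′ , v∼v′ , ≡2

    ≢0⇒1≤ : {x : Fin 3} → x ≢ 0F → 1 ≤ toℕ x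
    ≢0⇒1≤ {0F}    x≢0 = contradiction refl x≢0
    ≢0⇒1≤ {suc _} x≢0 = s≤s z≤n

    -- A column of weight at most 1 contains no 2. Undefended, it could then contain no 0 either,
    -- and its weight would be at least the order of `H`.
    light⇒defended : H.Nontrivial → ∀ {u} → W u ≤ 1 → Defended u
    light⇒defended 2≤n {u} W≤1 with defended? u
    ... | yes def = def
    ... | no ¬def = contradiction
      (≤-trans 2≤n (≤-trans (≤-reflexive (sym (∑-1 H)))
        (∑-mono H λ v → ≢0⇒1≤ {f (u , v)} λ ≡0 →
          let (_ , _ , ≡2) = undefended-zero ¬def ≡0
          in contradiction (≤-trans (2≤W ≡2) W≤1) λ { (s≤s ()) })))
      (<⇒≱ (s≤s W≤1))

    -- A column of weight at most 3 holds only one 2, so without outside help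
    -- every vertex of H carries a positive value or is adjacent to h.
    heavy⇒defended : ∀ {k} → k ≤ 3 → H.Δ + k ≤ H.order →
                     ∀ {u h} → f (u , h) ≡ 2F → W u ≤ k → Defended u
    heavy⇒defended {k} k≤3 Δ+k≤n {u} {h} ≡2 W≤k with defended? u
    ... | yes def = def
    ... | no ¬def = contradiction too-many (<⇒≱ ≤-refl)
      where
      open ≤-Reasoning

      unique : ∀ {v} → f (u , v) ≡ 2F → h ≡ v
      unique {v} ≡2′ with h H.≟ v
      ... | yes h≡v = h≡v
      -- Two distinct 2s in the column would weigh 4, which exceeds the bound 3 on `k`.
      ... | no h≢v  = contradiction
        (≤-trans (≤-reflexive (sym (cong₂ (λ i j → toℕ i + toℕ j) ≡2 ≡2′)))
          (≤-trans (two-terms≤∑ H (λ v → toℕ (f (u , v))) h≢v) (≤-trans W≤k k≤3)))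
        λ { (s≤s (s≤s (s≤s ()))) }

      -- The value 2 at `h` pays for the extra 1 there. Summation turns this surplus into the 1 by
      -- which the count exceeds the order of `H`.
      pointwise : ∀ v (h≟v : Dec (h ≡ v)) (h∼?v : Dec (h H.∼ v)) →
                  𝟙 h≟v + 1 ≤ 𝟙 h∼?v + toℕ (f (u , v))
      pointwise v (yes refl) h∼?v  rewrite ≡2 = m≤n+m 2 (𝟙 h∼?v)
      pointwise v (no _) (yes _)   = s≤s z≤n
      pointwise v (no _) (no h≁v)  = ≢0⇒1≤ λ ≡0 →
        let (v′ , v∼v′ , ≡2′) = undefended-zero ¬def ≡0
        in contradiction (H.∼-sym (subst (v H.∼_) (sym (unique ≡2′)) v∼v′)) h≁v

      too-many : suc H.order ≤ H.order
      too-many = begin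
        suc H.order                                ≡⟨ cong₂ _+_ (∑-point H h) (∑-1 H) ⟨
        H.∑ (λ v → 𝟙 (h H.≟ v)) + H.∑ (const 1)    ≡⟨ ∑-+ H (λ v → 𝟙 (h H.≟ v)) (const 1) ⟨
        H.∑ (λ v → 𝟙 (h H.≟ v) + 1)
          ≤⟨ ∑-mono H (λ v → pointwise v (h H.≟ v) (h H.∼? v)) ⟩
        H.∑ (λ v → 𝟙 (h H.∼? v) + toℕ (f (u , v)))
          ≡⟨ ∑-+ H (λ v → 𝟙 (h H.∼? v)) (λ v → toℕ (f (u , v))) ⟩
        H.degree h + W u                           ≤⟨ +-mono-≤ (degree≤Δ H h) W≤k ⟩
        H.Δ + k                                    ≤⟨ Δ+k≤n ⟩
        H.order                                    ∎

    -- The columns of weight at least 2 form a dominating set of `G`, since a lighter column is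
    -- defended by a column containing a 2. Each member pays 2 out of its own weight.
    2γ≤weight : H.Nontrivial → 2 * γ G ≤ weight (G ⊚ H) f
    2γ≤weight 2≤n = begin
      2 * γ G                     ≤⟨ *-monoʳ-≤ 2 (proj₂ (proj₂ (γ-minimum G)) D dominating) ⟩
      2 * G.∣ D ∣                 ≡⟨ ∑-* G 2 (λ u → 𝟙 (2 ≤? W u)) ⟨
      G.∑ (λ u → 2 * 𝟙 (2 ≤? W u)) ≤⟨ ∑-mono G (λ u → pointwise (2 ≤? W u)) ⟩
      G.∑ W                       ≡⟨ ∑-W ⟩
      weight (G ⊚ H) f            ∎
      where
      open ≤-Reasoning

      D : G.VSet
      D u = does (2 ≤? W u)

      pointwise : ∀ {w} (2≤?w : Dec (2 ≤ w)) → 2 * 𝟙 2≤?w ≤ w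
      pointwise (yes 2≤w) = 2≤w
      pointwise (no _)    = z≤n

      dominating : Dominating G D
      dominating u u∉D =
        let (y , u∼y , _ , ≡2) = light⇒defended 2≤n (s≤s⁻¹ (≰⇒> (u∉D ∘ dec-true (2 ≤? W u))))
        in y , u∼y , dec-true (2 ≤? W y) (2≤W ≡2)

    -- Repairing lone columns

    module _ (noIso : G.NoIsolated) (2≤n : H.Nontrivial)
             {k : ℕ} (k≤3 : k ≤ 3) (Δ+k≤n : H.Δ + k ≤ H.order) where

      private
        c : G.V → G.V
        c u = proj₁ (noIso u)

        -- Starting from all columns of weight at least 2, the `Lone` ones are exchanged for their
        -- chosen neighbour `c u` and the `Kept` ones stay.
        Heavy Lone Kept : G.V → Set
        Heavy u = k < W u
        Lone u  = 2 ≤ W u × W u ≤ k × ∀ y → u G.∼ y → ¬ 2 ≤ W y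
        Kept u  = 2 ≤ W u × ¬ Lone u

        heavy? : Decidable Heavy
        heavy? u = k <? W u

        lone? : Decidable Lone
        lone? u = (2 ≤? W u) ×-dec (W u ≤? k) ×-dec
                  allV? G λ y → (u G.∼? y) →-dec ¬? (2 ≤? W y)

        kept? : Decidable Kept
        kept? u = (2 ≤? W u) ×-dec ¬? (lone? u)

        -- If it were lone, its weight would be at most `k`, so `heavy⇒defended` would give a
        -- neighbouring column with a 2, hence of weight at least 2.
        2∈⇒¬lone : ∀ {u v} → f (u , v) ≡ 2F → ¬ Lone u
        2∈⇒¬lone ≡2 (_ , W≤k , alone) =
          let (y , u∼y , _ , ≡2′) = heavy⇒defended k≤3 Δ+k≤n ≡2 W≤k
          in alone y u∼y (2≤W ≡2′)

        -- Discarding the lone columns does no harm here. A light column is defended by a column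
        -- with a 2, which is not lone. A column of weight at least 2 that is not lone has a
        -- neighbour of weight at least 2, and that neighbour is not lone because of `u`.
        kept-neighbour : ∀ u → ¬ Lone u → W u ≤ k → ∃[ y ] u G.∼ y × Kept y
        kept-neighbour u ¬lone W≤k with 2 ≤? W u
        ... | no ≱2 =
          let (y , u∼y , _ , ≡2) = light⇒defended 2≤n (s≤s⁻¹ (≰⇒> ≱2))
          in y , u∼y , 2≤W ≡2 , 2∈⇒¬lone ≡2
        ... | yes 2≤Wu with anyV? G (λ y → (u G.∼? y) ×-dec (2 ≤? W y))
        ...   | yes (y , u∼y , 2≤Wy) =
          y , u∼y , 2≤Wy , λ (_ , _ , alone) → alone u (G.∼-sym u∼y) 2≤Wu
        ...   | no none =
          contradiction (2≤Wu , W≤k , λ y u∼y 2≤Wy → none (y , u∼y , 2≤Wy)) ¬lone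

      -- The columns without a guaranteed kept neighbour are the lone and the heavy ones, so for
      -- exactly these `c u` is added.
      2γₜ≤weight : 3 ≤ k → 2 * γₜ G noIso ≤ weight (G ⊚ H) f
      2γₜ≤weight 3≤k = begin
        2 * γₜ G noIso
          ≤⟨ *-monoʳ-≤ 2 (proj₂ (proj₂ (γₜ-minimum G noIso)) S totalDominating) ⟩
        2 * G.∣ S ∣
          ≤⟨ *-monoʳ-≤ 2 (∑-⊎-image G c kept? repaired?) ⟩
        2 * G.∑ (λ u → 𝟙 (kept? u) + 𝟙 (repaired? u))
          ≡⟨ ∑-* G 2 (λ u → 𝟙 (kept? u) + 𝟙 (repaired? u)) ⟨
        G.∑ (λ u → 2 * (𝟙 (kept? u) + 𝟙 (repaired? u)))
          ≤⟨ ∑-mono G (λ u → pointwise u (2 ≤? W u) (lone? u) (heavy? u)) ⟩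
        G.∑ W
          ≡⟨ ∑-W ⟩
        weight (G ⊚ H) f ∎
        where
        open ≤-Reasoning

        repaired? : Decidable (λ u → Lone u ⊎ Heavy u)
        repaired? u = lone? u ⊎-dec heavy? u

        member? : Decidable (λ u → Kept u ⊎ Image G c (λ u → Lone u ⊎ Heavy u) u)
        member? u = kept? u ⊎-dec image? G c repaired? u

        S : G.VSet
        S u = does (member? u)

        pointwise : ∀ u (t : Dec (2 ≤ W u)) (l : Dec (Lone u)) (h : Dec (Heavy u)) →
                    2 * (𝟙 (t ×-dec ¬? l) + 𝟙 (l ⊎-dec h)) ≤ W u
        pointwise u (no ≱2)  (yes (2≤ , _))    _       = contradiction 2≤ ≱2
        pointwise u (no ≱2)  (no _)            (yes k<W) =
          contradiction (≤-trans (n≤1+n 2) (≤-trans (≤-trans 3≤k (n≤1+n k)) k<W)) ≱2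
        pointwise u (no _)   (no _)            (no _)  = z≤n
        pointwise u (yes _)  (yes (2≤ , _))    _       = 2≤
        -- A heavy column weighs at least 4: 2 for itself and 2 for its added neighbour.
        pointwise u (yes _)  (no _)            (yes k<W) = ≤-trans (s≤s 3≤k) k<W
        pointwise u (yes 2≤) (no _)            (no _)  = 2≤

        totalDominating : TotalDominating G S
        totalDominating u with repaired? u
        ... | yes r = c u , proj₂ (noIso u) , dec-true (member? (c u)) (inj₂ (u , r , refl))
        ... | no ¬r =
          let (y , u∼y , kept) = kept-neighbour u (¬r ∘ inj₁) (≮⇒≥ (¬r ∘ inj₂))
          in y , u∼y , dec-true (member? y) (inj₁ kept)

      -- A dominating couple demands no neighbour for members of `B`. So heavy columns go into `B`,
      -- where their weight of at least 3 covers the price, and only lone columns need a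
      -- replacement.
      ζ≤weight : 2 ≤ k → ζ G ≤ weight (G ⊚ H) f
      ζ≤weight 2≤k = begin
        ζ G
          ≤⟨ proj₂ (proj₂ (ζ-minimum G)) (A , B) (disjoint , dominating) ⟩
        2 * G.∣ A ∣ + 3 * G.∣ B ∣
          ≤⟨ +-monoˡ-≤ (3 * G.∣ B ∣) (*-monoʳ-≤ 2 (∑-⊎-image G c rest? lone?)) ⟩
        2 * G.∑ (λ u → 𝟙 (rest? u) + 𝟙 (lone? u)) + 3 * G.∣ B ∣
          ≡⟨ cong₂ _+_ (∑-* G 2 (λ u → 𝟙 (rest? u) + 𝟙 (lone? u))) (∑-* G 3 (λ u → 𝟙 (heavy? u))) ⟨
        G.∑ (λ u → 2 * (𝟙 (rest? u) + 𝟙 (lone? u))) + G.∑ (λ u → 3 * 𝟙 (heavy? u))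
          ≡⟨ ∑-+ G (λ u → 2 * (𝟙 (rest? u) + 𝟙 (lone? u))) (λ u → 3 * 𝟙 (heavy? u)) ⟨
        G.∑ (λ u → 2 * (𝟙 (rest? u) + 𝟙 (lone? u)) + 3 * 𝟙 (heavy? u))
          ≤⟨ ∑-mono G (λ u → pointwise u (2 ≤? W u) (lone? u) (heavy? u)) ⟩
        G.∑ W
          ≡⟨ ∑-W ⟩
        weight (G ⊚ H) f ∎
        where
        open ≤-Reasoning

        rest? : Decidable (λ u → Kept u × ¬ Heavy u)
        rest? u = kept? u ×-dec ¬? (heavy? u)

        inA? : Decidable (λ u → (Kept u × ¬ Heavy u) ⊎ Image G c Lone u)
        inA? u = rest? u ⊎-dec image? G c lone? u

        A B : G.VSet
        A u = does (inA? u)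
        B u = does (heavy? u)

        pointwise : ∀ u (t : Dec (2 ≤ W u)) (l : Dec (Lone u)) (h : Dec (Heavy u)) →
                    2 * (𝟙 ((t ×-dec ¬? l) ×-dec ¬? h) + 𝟙 l) + 3 * 𝟙 h ≤ W u
        pointwise u _        (yes (_ , W≤k , _)) (yes k<W) = contradiction W≤k (<⇒≱ k<W)
        pointwise u (yes _)  (yes (2≤ , _))      (no _)    = 2≤
        pointwise u (no _)   (yes (2≤ , _))      (no _)    = 2≤
        pointwise u (yes _)  (no _)              (yes k<W) = ≤-trans (s≤s 2≤k) k<W
        pointwise u (no _)   (no _)              (yes k<W) = ≤-trans (s≤s 2≤k) k<W
        pointwise u (yes 2≤) (no _)              (no _)    = 2≤
        pointwise u (no _)   (no _)              (no _)    = z≤n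

        disjoint : Disjoint G A B
        disjoint u (u∈A , u∈B) with does⇒ (inA? u) u∈A | does⇒ (heavy? u) u∈B
        ... | inj₁ (_ , ¬heavy)                    | heavy = ¬heavy heavy
        -- The replacement of a lone column is a neighbour of it and weighs less than 2, so it
        -- cannot be heavy.
        ... | inj₂ (x , (_ , _ , alone) , refl) | heavy =
          alone (c x) (proj₂ (noIso x)) (≤-trans 2≤k (<⇒≤ heavy))

        dominating : ∀ u → u G.∉ B → ∃[ y ] u G.∼ y × (y G.∈ A ⊎ y G.∈ B)
        dominating u u∉B with lone? u
        ... | yes lone =
          c u , proj₂ (noIso u) , inj₁ (dec-true (inA? (c u)) (inj₂ (u , lone , refl)))
        ... | no ¬lone with kept-neighbour u ¬lone (≮⇒≥ (u∉B ∘ dec-true (heavy? u)))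
        ...   | y , u∼y , kept with heavy? y
        ...     | yes heavy = y , u∼y , inj₂ (dec-true (heavy? y) heavy)
        ...     | no ¬heavy = y , u∼y , inj₁ (dec-true (inA? y) (inj₁ (kept , ¬heavy)))

-- The three cases

theorem3p6 : (G H : Graph) (noIso : Graph.NoIsolated G) → Graph.Nontrivial H →
    (Graph.Δ H + 1 ≡ Graph.order H → γR (G ⊚ H) ≡ 2 * γ G) ×
    (Graph.Δ H + 2 ≡ Graph.order H → γR (G ⊚ H) ≡ ζ G) ×
    (Graph.Δ H + 3 ≤ Graph.order H → γR (G ⊚ H) ≡ 2 * γₜ G noIso)
theorem3p6 G H noIso 2≤n =
  (λ Δ+1≡n → ≤-antisym
    (attained-≤ (2 *_) (proj₂ (γ-minimum G)) λ D D-dom → γR≤2∣D∣ D λ u v →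
      case _∈?_ G u D of λ where
        -- Here `h₀` is adjacent to all other vertices of `H`, so its 2 serves the whole column.
        (yes u∈D) → inj₂ (inj₁ (inj₁ u∈D , universal H (trans (cong (_+ 1) degree-h₀) Δ+1≡n) v))
        (no u∉D)  → let (y , u∼y , y∈D) = D-dom u u∉D in inj₁ (y , u∼y , inj₁ y∈D))
    (attained-≤ id γR-min λ f dom → 2γ≤weight G H f dom 2≤n)) ,
  (λ Δ+2≡n → ≤-antisym
    -- In a column over `B`, the 2 at `h₀` reaches every vertex but `h₁`, and the 1 goes there.
    (let (h₁ , near) = almost-universal H (trans (cong (_+ 2) degree-h₀) Δ+2≡n) in
     attained-≤ id (proj₂ (ζ-minimum G)) λ (A , B) (_ , AB-dom) →
     γR-≤-coupleCost G H {A} {B} {h₀} {h₁} λ u v → case (_∈?_ G u B , near v) of λ where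
       (no u∉B  , _)           → inj₁ (AB-dom u u∉B)
       (yes u∈B , inj₁ closed) → inj₂ (inj₁ (inj₂ u∈B , closed))
       (yes u∈B , inj₂ v≡h₁)   → inj₂ (inj₂ (u∈B , v≡h₁)))
    (attained-≤ id γR-min λ f dom →
      ζ≤weight G H f dom noIso 2≤n (n≤1+n 2) (≤-reflexive Δ+2≡n) ≤-refl)) ,
  (λ Δ+3≤n → ≤-antisym
    (attained-≤ (2 *_) (proj₂ (γₜ-minimum G noIso)) λ D D-dom → γR≤2∣D∣ D λ u v →
      -- Total domination puts a 2 in a column next to every column, including those over `D`.
      let (y , u∼y , y∈D) = D-dom u in inj₁ (y , u∼y , inj₁ y∈D))
    (attained-≤ id γR-min λ f dom → 2γₜ≤weight G H f dom noIso 2≤n ≤-refl Δ+3≤n ≤-refl))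
  where
  module G = Graph G
  module H = Graph H

  γR-min : IsMinimum (RomanDominating (G ⊚ H)) (weight (G ⊚ H)) (γR (G ⊚ H))
  γR-min = proj₂ (γR-minimum (G ⊚ H))

  h₀ : H.V
  -- Read as `1 < order`, nontriviality supplies the vertex of index 1 as a witness that `H` is
  -- inhabited.
  h₀ = proj₁ (Δ-attained H (H.vertex (fromℕ< 2≤n)))

  degree-h₀ : H.degree h₀ ≡ H.Δ
  degree-h₀ = proj₂ (Δ-attained H (H.vertex (fromℕ< 2≤n)))

  ∅ : G.VSet
  ∅ = const false

  -- This is the couple with second set empty. No 1 is placed then, and `h₀` fills the position of
  -- `h₁`.
  γR≤2∣D∣ : ∀ D →
    (∀ u v → (∃[ y ] u G.∼ y × (y G.∈ D ⊎ y G.∈ ∅))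
           ⊎ ((u G.∈ D ⊎ u G.∈ ∅) × (v ≡ h₀ ⊎ h₀ H.∼ v))
           ⊎ (u G.∈ ∅ × v ≡ h₀)) →
    γR (G ⊚ H) ≤ 2 * G.∣ D ∣
  γR≤2∣D∣ D covered = ≤-trans (γR-≤-coupleCost G H {D} {∅} {h₀} {h₀} covered)
    (≤-reflexive (trans (cong (λ n → 2 * G.∣ D ∣ + 3 * n) (sum-replicate-zero G.order))
                        (+-identityʳ (2 * G.∣ D ∣))))
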